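{- Let $a\in\Sigma$ be an action and $p\in\{1,2\}$ a party. Obligation is stricter than permission: (i) $\mathcal{P}_p(a)\sqsubseteq\mathcal{O}_p(a)$; and (ii) $\mathcal{P}_p(!a)\sqsubseteq\mathcal{O}_p(!a)$.
   Context: Parties are $p\in\{1,2\}$; $\overline{p}$ is the other party. A multi-action automaton is a tuple $\langle\Sigma,Q,q0,\rightarrow\rangle$ with $\Sigma$ an alphabet of actions, $Q$ a set of states, $q0\in Q$ initial, and ${\rightarrow}\subseteq Q\times 2^\Sigma\times Q$. Write $q\xrightarrow{A}q'$ for $(q,A,q')\in{\rightarrow}$ and $\mathrm{acts}(q)=\{A\mid\exists q'.\ q\xrightarrow{A}q'\}$. It is total if for every $q\in Q$, $A\subseteq\Sigma$ there is $q'$ with $q\xrightarrow{A}q'$. The synchronous composition $S_1\|_G S_2$ of two automata over $\Sigma$ has state set $Q_1\times Q_2$, initial state $(q0_1,q0_2)$ and transitions: $(q_1,q_2)\xrightarrow{A}(q_1',q_2)$ if $q_1\xrightarrow{A}_1q_1'$ and $A\cap G=\emptyset$; $(q_1,q_2)\xrightarrow{A}(q_1,q_2')$ if $q_2\xrightarrow{A}_2q_2'$ and $A\cap G=\emptyset$; $(q_1,q_2)\xrightarrow{A\cup B}(q_1',q_2')$ if $q_1\xrightarrow{A}_1q_1'$, $q_2\xrightarrow{B}_2q_2'$ and $A\cap G=B\cap G\neq\emptyset$. $\Sigma!=\Sigma\cup\{!a\mid a\in\Sigma\}$, where $!a$ denotes absence of $a$, and $!x$ means $a$ when $x={!a}$.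 A clause is $\mathcal{O}_p(x)$ (party $p$ is obliged to perform $x$) or $\mathcal{P}_p(x)$ (party $p$ is permitted to perform $x$), $x\in\Sigma!$, $p\in\{1,2\}$. A contract automaton is a total, deterministic multi-action automaton with a total function $\mathrm{contract}$ assigning a set of clauses to each state. A regulated two-party system $R=\langle S_1,S_2\rangle^{\mathcal A}_G$ consists of multi-action automata $S_1,S_2$ (behaviours of parties 1 and 2, with alphabets $\Sigma_1,\Sigma_2$, $\Sigma=\Sigma_1\cup\Sigma_2$), a set $G$ of synchronised actions, and a contract automaton $\mathcal A$ over $\Sigma$. Its behaviour is the automaton $(S_1\|_GS_2)\|_\Sigma\mathcal A$, with states written $(q_1,q_2)_{q_{\mathcal A}}$. All systems are assumed well-formed: $\mathrm{acts}((q_1,q_2))\ne\emptyset$ for all states $(q_1,q_2)$ of $S_1\|_GS_2$. $G^c$ is the complement of $G$ in $\Sigma$. Let $O_p(q_{\mathcal A})=\{a\mid\mathcal{O}_p(a)\in\mathrm{contract}(q_{\mathcal A})\}$, $F_p(q_{\mathcal A})=\{a\mid\mathcal{O}_p(!a)\in\mathrm{contract}(q_{\mathcal A})\}$, and $\mathrm{viable}_p(q_{\mathcal A},A)$ iff $O_p(q_{\mathcal A})\subseteq A$ and $F_p(q_{\mathcal A})\cap A=\emptyset$. Satisfaction (of $\mathcal A$, by a party, at a state or transition $X$ of the behaviour): - Permission. A clause $\mathcal{P}_p(a)$ is always satisfied by $p$; it is satisfied by $\overline p$ at state $(q_1,q_2)_{q_{\mathcal A}}$ iff $a\in G$ implies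 $\exists A\in\mathrm{acts}(q_{\overline p}),A'\subseteq G^c$ with $a\in A$ and $\mathrm{viable}_p(q_{\mathcal A},A\cup A')$. The clause $\mathcal{P}_p(!a)$ is treated identically with $a\notin A$ in place of $a\in A$. $\mathrm{sat}^P_p((q_1,q_2)_{q_{\mathcal A}})$ holds iff every clause $\mathcal{P}_{\overline p}(x)\in\mathrm{contract}(q_{\mathcal A})$ is satisfied by $p$ there; $\mathrm{sat}^P_p$ is true on all transitions. - Obligation. On a transition $(q_1,q_2)_{q_{\mathcal A}}\xrightarrow{A}(q_1',q_2')_{q_{\mathcal A}'}$, $\mathrm{sat}^O_p$ holds iff $\mathrm{viable}_p(q_{\mathcal A},A)$, except that it is true if $A$ is performed asynchronously by $\overline p$. On a state, $\mathrm{sat}^O_{\overline p}((q_1,q_2)_{q_{\mathcal A}})$ holds iff $\exists A\in\mathrm{acts}(q_{\overline p}),A'\subseteq G^c$ with $\mathrm{viable}_p(q_{\mathcal A},A\cup A')$. - $\mathrm{sat}^{\mathcal A}_p(X)$ iff $\mathrm{sat}^P_p(X)\wedge\mathrm{sat}^O_p(X)$. $\mathrm{breachIncapable}_p(R)$ holds if $\mathrm{sat}^{\mathcal A}_p(X)$ holds for all reachable states and transitions $X$ of the behaviour of $R$. Strictness of contract automata: $\mathcal A\sqsubseteq_p\mathcal A'$ iff for all systems $S_1,S_2$, $\mathrm{breachIncapable}_p(\langle S_1,S_2\rangle^{\mathcal A'}_G)\Rightarrow\mathrm{breachIncapable}_p(\langle S_1,S_2\rangle^{\mathcal A}_G)$;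 $\mathcal A\sqsubseteq\mathcal A'$ iff $\mathcal A\sqsubseteq_p\mathcal A'$ for both parties. Strictness of clauses: $[C\rightarrow C']$ relates $\mathcal A$ to $\mathcal A'$ if they are the same except possibly for a number of instances of clause $C$ (in $\mathcal A$) replaced by $C'$ (in $\mathcal A'$). $C\sqsubseteq_pC'$ ($C'$ is stricter than $C$ for $p$) iff $\mathcal A\sqsubseteq_p\mathcal A'$ for all $(\mathcal A,\mathcal A')\in[C\rightarrow C']$; $C\sqsubseteq C'$ iff this holds for both parties. -}

module Defs where

open import Data.Product using (_×_; _,_; proj₁; proj₂; ∃; ∃-syntax)
open import Data.Sum using (_⊎_)
open import Level using (0ℓ)
open import Relation.Binary.Construct.Closure.ReflexiveTransitive using (Star)
open import Relation.Binary.PropositionalEquality using (_≡_)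
open import Relation.Unary
  using (Pred; _∈_; _∉_; _⊆_; _≐_; _∩_; _∪_; ∁; U; ｛_｝; Empty; Satisfiable)

data Party : Set where
  one two : Party

other : Party → Party
other one = two
other two = one

-- 2^Σ is rendered as Pred Σ 0ℓ.  Sets of actions are identified up to
-- extensional equality _≐_, which transition relations must respect.
record Automaton (Σ : Set) : Set₂ where
  field
    State      : Set
    init       : State
    _—[_]→_    : State → Pred Σ 0ℓ → State → Set₁
    —→-resp-≐  : ∀ {q q′ A B} → A ≐ B → q —[ A ]→ q′ → q —[ B ]→ q′

  acts : State → Pred (Pred Σ 0ℓ) _
  acts q A = ∃[ q′ ] q —[ A ]→ q′

  Reachable : Pred State _
  Reachable = Star (λ q q′ → ∃[ A ] q —[ A ]→ q′) init

  Total : Set₁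
  Total = ∀ q A → ∃[ q′ ] q —[ A ]→ q′

  Deterministic : Set₁
  Deterministic = ∀ q A {q′ q″} → q —[ A ]→ q′ → q —[ A ]→ q″ → q′ ≡ q″

  -- The transition labels only use actions of the sub-alphabet.
  Over : Pred Σ 0ℓ → Set₁
  Over Σ′ = ∀ {q A q′} → q —[ A ]→ q′ → A ⊆ Σ′

module _ {Σ : Set} (M N : Automaton Σ) (G : Pred Σ 0ℓ) where
  private
    module M = Automaton M
    module N = Automaton N

  data Step : M.State × N.State → Pred Σ 0ℓ → M.State × N.State → Set₁ where
    left  : ∀ {m m′ n A} → m M.—[ A ]→ m′ → Empty (A ∩ G) →
            Step (m , n) A (m′ , n)
    right : ∀ {m n n′ A} → n N.—[ A ]→ n′ → Empty (A ∩ G) →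
            Step (m , n) A (m , n′)
    sync  : ∀ {m m′ n n′ A B C} → m M.—[ A ]→ m′ → n N.—[ B ]→ n′ →
            (A ∩ G) ≐ (B ∩ G) → Satisfiable (A ∩ G) → C ≐ (A ∪ B) →
            Step (m , n) C (m′ , n′)

  private
    Empty-resp : ∀ {A B : Pred Σ 0ℓ} → A ≐ B → Empty (A ∩ G) → Empty (B ∩ G)
    Empty-resp (_ , B⊆A) e x (x∈B , x∈G) = e x (B⊆A x∈B , x∈G)

    Step-resp-≐ : ∀ {s s′ A B} → A ≐ B → Step s A s′ → Step s B s′
    Step-resp-≐ eq (left t e)  = left (M.—→-resp-≐ eq t) (Empty-resp eq e)
    Step-resp-≐ eq (right t e) = right (N.—→-resp-≐ eq t) (Empty-resp eq e)
    Step-resp-≐ (A⊆B , B⊆A) (sync t u same ne (C⊆ , ⊆C)) =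
      sync t u same ne ((λ x → C⊆ (B⊆A x)) , (λ x → A⊆B (⊆C x)))

  compose : Automaton Σ
  compose = record
    { State     = M.State × N.State
    ; init      = M.init , N.init
    ; _—[_]→_   = Step
    ; —→-resp-≐ = Step-resp-≐
    }

-- The elements of Σ!.
data Literal (Σ : Set) : Set where
  pos neg : Σ → Literal Σ

module _ {Σ : Set} where

  _complies_ : Pred Σ 0ℓ → Literal Σ → Set
  A complies pos a = a ∈ A
  A complies neg a = a ∉ A

  action : Literal Σ → Σ
  action (pos a) = a
  action (neg a) = a

data Clause (Σ : Set) : Set where
  𝓞 𝓟 : Party → Literal Σ → Clause Σ

record ContractAutomaton (Σ : Set) : Set₂ where
  constructor mkContract
  field
    automaton     : Automaton Σ
    total         : Automaton.Total automaton
    deterministic : Automaton.Deterministic automaton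
    contract      : Automaton.State automaton → Pred (Clause Σ) 0ℓ

-- The data S₁, S₂, G of a regulated two-party system; Σ is the union of the
-- parties' alphabets.
record System (Σ : Set) : Set₂ where
  field
    alphabet : Party → Pred Σ 0ℓ
    S        : Party → Automaton Σ
    over     : ∀ p → Automaton.Over (S p) (alphabet p)
    covers   : U ⊆ (alphabet one ∪ alphabet two)
    G        : Pred Σ 0ℓ

  parties : Automaton Σ
  parties = compose (S one) (S two) G

  field
    wellFormed : ∀ q → Satisfiable (Automaton.acts parties q)

  local : ∀ p → Automaton.State parties → Automaton.State (S p)
  local one (q₁ , q₂) = q₁
  local two (q₁ , q₂) = q₂

module Regulated {Σ : Set} (sys : System Σ) (𝓐 : ContractAutomaton Σ) where
  open System sys
  private
    module S p = Automaton (S p)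
    module P = Automaton parties
  open ContractAutomaton 𝓐 using (automaton; contract)
  private
    module K = Automaton automaton

  behaviour : Automaton Σ
  behaviour = compose parties automaton U

  module B = Automaton behaviour

  obliged : Party → K.State → Pred Σ 0ℓ
  obliged p q a = 𝓞 p (pos a) ∈ contract q

  forbidden : Party → K.State → Pred Σ 0ℓ
  forbidden p q a = 𝓞 p (neg a) ∈ contract q

  Viable : Party → K.State → Pred Σ 0ℓ → Set
  Viable p q A = obliged p q ⊆ A × Empty (forbidden p q ∩ A)

  -- Satisfaction of 𝓟 p x by the other party; p itself always satisfies it.
  PermissionSat : Party → Literal Σ → Pred B.State _
  PermissionSat p x (q , k) = action x ∈ G →
    ∃[ A ] ∃[ A′ ] A ∈ S.acts (other p) (local (other p) q) × A′ ⊆ ∁ G ×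
      A complies x × Viable p k (A ∪ A′)

  Satᴾ : Party → Pred B.State _
  Satᴾ p s@(_ , k) =
    ∀ x → 𝓟 (other p) x ∈ contract k → PermissionSat (other p) x s

  Satᴼ : Party → Pred B.State _
  Satᴼ p (q , k) =
    ∃[ A ] ∃[ A′ ] A ∈ S.acts p (local p q) × A′ ⊆ ∁ G ×
      Viable (other p) k (A ∪ A′)

  -- Transitions are derivations, so a self-loop that both parties could perform
  -- alone counts once for each of them.
  data PartyAsync : Party → ∀ {q A q′} → q P.—[ A ]→ q′ → Set₁ where
    async₁ : ∀ {q₁ q₁′ q₂ A} {t : S._—[_]→_ one q₁ A q₁′} {e} →
             PartyAsync one (left {n = q₂} t e)
    async₂ : ∀ {q₁ q₂ q₂′ A} {t : S._—[_]→_ two q₂ A q₂′} {e} →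
             PartyAsync two (right {m = q₁} t e)

  -- The contract automaton may also step alone on the empty set of actions;
  -- such a transition is performed by neither party.
  data Async (p : Party) : ∀ {s A s′} → s B.—[ A ]→ s′ → Set₁ where
    left : ∀ {q q′ k A} {t : q P.—[ A ]→ q′} {e} → PartyAsync p t →
           Async p (left {n = k} t e)
    sync : ∀ {q q′ k k′ A B C} {t : q P.—[ A ]→ q′} {u : k K.—[ B ]→ k′}
           {same ne} {eq : C ≐ (A ∪ B)} → PartyAsync p t →
           Async p (sync t u same ne eq)

  -- The permission part of satisfaction is true on every transition.
  SatTransition : Party → ∀ {s A s′} → s B.—[ A ]→ s′ → Set₁
  SatTransition p {_ , k} {A} t = Async (other p) t ⊎ Viable p k A

  SatState : Party → Pred B.State _
  SatState p s = Satᴾ p s × Satᴼ p s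

  BreachIncapable : Party → Set₁
  BreachIncapable p =
    (∀ s → B.Reachable s → SatState p s) ×
    (∀ {s A s′} → B.Reachable s → (t : s B.—[ A ]→ s′) → SatTransition p t)

module _ {Σ : Set} where

  StricterFor : Party → ContractAutomaton Σ → ContractAutomaton Σ → Set₂
  StricterFor p 𝓐 𝓐′ = ∀ (sys : System Σ) →
    Regulated.BreachIncapable sys 𝓐′ p → Regulated.BreachIncapable sys 𝓐 p

  -- R is the rest of the clause set, left untouched by the replacement.
  Replaced : Clause Σ → Clause Σ → Pred (Clause Σ) 0ℓ → Pred (Clause Σ) 0ℓ → Set₁
  Replaced C C′ K K′ =
    ∃[ R ] C ∉ R × K ≐ (R ∪ ｛ C ｝) × K′ ≐ (R ∪ ｛ C′ ｝)

  data [_⇝_] (C C′ : Clause Σ) : ContractAutomaton Σ → ContractAutomaton Σ → Set₂ where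
    replace : ∀ {M tot tot′ det det′ contract contract′} →
              (∀ q → (contract q ≐ contract′ q) ⊎
                     Replaced C C′ (contract q) (contract′ q)) →
              [ C ⇝ C′ ] (mkContract M tot det contract)
                         (mkContract M tot′ det′ contract′)

  _⊑[_]_ : Clause Σ → Party → Clause Σ → Set₂
  C ⊑[ p ] C′ = ∀ {𝓐 𝓐′} → [ C ⇝ C′ ] 𝓐 𝓐′ → StricterFor p 𝓐 𝓐′

  _⊑_ : Clause Σ → Clause Σ → Set₂
  C ⊑ C′ = ∀ p → C ⊑[ p ] C′

{-# OPTIONS --safe #-}

-- Replacing permissions by obligations only adds obligations, so whatever is
-- viable under the stricter contract is viable under the laxer one.  A weakened
-- clause about p and a synchronised action a is satisfied by the other party
-- because its obligation half already offers an action set A that is viable for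
-- p after adding some A′ outside G: as a ∈ G, it is A itself that complies.

module Submission where

open import Data.Empty using (⊥-elim)
open import Data.Product using (_×_; _,_)
open import Data.Sum using (_⊎_; inj₁; inj₂; [_,_]′; map)
open import Level using (0ℓ)
open import Relation.Binary.PropositionalEquality using (refl)
open import Relation.Unary using (Pred; _∈_; _⊆_; _≐_; _∪_; ∁)
open import Defs

module _ {Σ : Set} where

  -- Forgets which clause was replaced and where, so that changed and unchanged states are treated
  -- alike.
  record Relaxes (K K′ : Pred (Clause Σ) 0ℓ) : Set where
    field
      obligation : ∀ {p x} → 𝓞 p x ∈ K → 𝓞 p x ∈ K′
      permission : ∀ {p x} → 𝓟 p x ∈ K → 𝓟 p x ∈ K′ ⊎ 𝓞 p x ∈ K′

  open Relaxes

  ≐⇒relaxes : ∀ {K K′} → K ≐ K′ → Relaxes K K′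
  ≐⇒relaxes (K⊆K′ , _) .obligation c = K⊆K′ c
  ≐⇒relaxes (K⊆K′ , _) .permission c = inj₁ (K⊆K′ c)

  replaced⇒relaxes : ∀ {p x K K′} → Replaced (𝓟 p x) (𝓞 p x) K K′ → Relaxes K K′
  replaced⇒relaxes (_ , _ , (K⊆ , _) , (_ , ⊆K′)) .obligation c with K⊆ c
  ... | inj₁ r  = ⊆K′ (inj₁ r)
  ... | inj₂ ()
  replaced⇒relaxes (_ , _ , (K⊆ , _) , (_ , ⊆K′)) .permission c with K⊆ c
  ... | inj₁ r    = inj₁ (⊆K′ (inj₁ r))
  ... | inj₂ refl = inj₂ (⊆K′ (inj₂ refl))

  module _ (M : Automaton Σ) (tot tot′ : Automaton.Total M)
           (det det′ : Automaton.Deterministic M)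
           {contract contract′ : Automaton.State M → Pred (Clause Σ) 0ℓ}
           (relaxes : ∀ k → Relaxes (contract k) (contract′ k))
           (sys : System Σ) where
    private
      module R  = Regulated sys (mkContract M tot det contract)
      module R′ = Regulated sys (mkContract M tot′ det′ contract′)
    open System sys using (G)

    viable : ∀ {p k A} → R′.Viable p k A → R.Viable p k A
    viable {k = k} (must , mustNot) =
      (λ o → must (relaxes k .obligation o)) ,
      (λ b (f , b∈A) → mustNot b (relaxes k .obligation f , b∈A))

    -- Viability puts an obliged `a` into `A ∪ A′`, and `a ∈ G` rules out `A′`; a forbidden `a` is
    -- kept out of all of `A ∪ A′`, hence out of `A`.
    obligation⇒complies : ∀ {p k A A′} x → 𝓞 p x ∈ contract′ k → action x ∈ G →
                          A′ ⊆ ∁ G → R′.Viable p k (A ∪ A′) → A complies x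
    obligation⇒complies (pos a) o a∈G A′⊆∁G (must , _) =
      [ (λ a∈A → a∈A) , (λ a∈A′ → ⊥-elim (A′⊆∁G a∈A′ a∈G)) ]′ (must o)
    obligation⇒complies (neg a) o _ _ (_ , mustNot) a∈A = mustNot a (o , inj₁ a∈A)

    satᴼ : ∀ p {s} → R′.Satᴼ p s → R.Satᴼ p s
    satᴼ _ (A , A′ , acts , A′⊆∁G , v) = A , A′ , acts , A′⊆∁G , viable v

    permissionSat : ∀ p {x s} → R′.PermissionSat p x s → R.PermissionSat p x s
    permissionSat _ sat a∈G with sat a∈G
    ... | A , A′ , acts , A′⊆∁G , ok , v = A , A′ , acts , A′⊆∁G , ok , viable v

    obligation⇒permissionSat : ∀ p {x q k} → 𝓞 (other p) x ∈ contract′ k →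
                               R′.Satᴼ p (q , k) → R.PermissionSat (other p) x (q , k)
    -- The split on the party lets `other (other p)` reduce to `p`.
    obligation⇒permissionSat one {x} o (A , A′ , acts , A′⊆∁G , v) a∈G =
      A , A′ , acts , A′⊆∁G , obligation⇒complies x o a∈G A′⊆∁G v , viable v
    obligation⇒permissionSat two {x} o (A , A′ , acts , A′⊆∁G , v) a∈G =
      A , A′ , acts , A′⊆∁G , obligation⇒complies x o a∈G A′⊆∁G v , viable v

    -- A permission that became an obligation draws its witness from the `Satᴼ` half, hence the
    -- whole `SatState` as premise.
    satᴾ : ∀ p {s} → R′.SatState p s → R.Satᴾ p s
    satᴾ p {_ , k} (satP , satO) x c with relaxes k .permission c
    ... | inj₁ c′ = permissionSat (other p) {x} (satP x c′)
    ... | inj₂ o  = obligation⇒permissionSat p o satO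

    -- Both contracts sit on the same `M`, so the behaviours coincide definitionally; only the
    -- predicates indexed by the contract automaton have to be carried over.
    partyAsync : ∀ {p q A q′} {t : Automaton._—[_]→_ (System.parties sys) q A q′} →
                 R′.PartyAsync p t → R.PartyAsync p t
    partyAsync R′.async₁ = R.async₁
    partyAsync R′.async₂ = R.async₂

    async : ∀ {p s A s′} {t : Automaton._—[_]→_ R.behaviour s A s′} →
            R′.Async p t → R.Async p t
    async (R′.left t) = R.left (partyAsync t)
    async (R′.sync t) = R.sync (partyAsync t)

    breachIncapable : ∀ p → R′.BreachIncapable p → R.BreachIncapable p
    breachIncapable p (states , transitions) =
      (λ s r → let sat@(_ , satO) = states s r in satᴾ p sat , satᴼ p satO) ,
      (λ r t → map async viable (transitions r t))

  permission⊑obligation : ∀ p (x : Literal Σ) → 𝓟 p x ⊑ 𝓞 p x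
  permission⊑obligation _ _ p′ (replace {M} {tot} {tot′} {det} {det′} changes) sys =
    breachIncapable M tot tot′ det det′
      (λ k → [ ≐⇒relaxes , replaced⇒relaxes ]′ (changes k)) sys p′

theorem1 : ∀ {Σ : Set} (a : Σ) (p : Party) →
    (𝓟 p (pos a) ⊑ 𝓞 p (pos a)) × (𝓟 p (neg a) ⊑ 𝓞 p (neg a))
theorem1 a p = permission⊑obligation p (pos a) , permission⊑obligation p (neg a)
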